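{- Let $n\ge d+1\ge 3$ be integers and let $\mathcal{F}\subseteq\binom{[n]}{d+1}$. Suppose that for every $F\in\mathcal{F}$ there exists a subset $B_F\subseteq F$ with $|B_F|=d$ such that $F'\cap F\neq B_F$ for every $F'\in\mathcal{F}$. Then $|\mathcal{F}|\le\binom{n-1}{d}$. Moreover, equality holds if and only if $\mathcal{F}$ is a star of size $\binom{n-1}{d}$, i.e. $\mathcal{F}=\{F\in\binom{[n]}{d+1}: a\in F\}$ for some $a\in[n]$.
   Context: $\binom{[n]}{k}$ denotes the family of all $k$-element subsets of $[n]=\{1,\dots,n\}$. A star is a family all of whose members contain a common element. -}

module Defs where

open import Data.Nat using (ℕ)
open import Data.Fin using (Fin)
open import Data.Fin.Subset using (Subset; _∈_; _⊆_; _∩_; ∣_∣)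
open import Data.List using (List; length)
import Data.List.Membership.Propositional as List
open import Data.List.Relation.Unary.All using (All)
open import Data.List.Relation.Unary.Unique.Propositional using (Unique)
open import Data.Product using (_×_; ∃-syntax)
open import Function.Bundles using (_⇔_)
open import Relation.Binary.PropositionalEquality using (_≡_; _≢_)

-- A family of k-element subsets of an n-element ground set, listed without
-- repetition; the order of the list carries no meaning.
record UniformFamily (n k : ℕ) : Set where
  field
    members  : List (Subset n)
    distinct : Unique members
    uniform  : All (λ F → ∣ F ∣ ≡ k) members

open UniformFamily public

infix 4 _∈ᶠ_

_∈ᶠ_ : ∀ {n k} → Subset n → UniformFamily n k → Set
F ∈ᶠ 𝓕 = F List.∈ members 𝓕

size : ∀ {n k} → UniformFamily n k → ℕ
size 𝓕 = length (members 𝓕)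

-- F′ ranges over the whole family, F included.
MissesTrace : ∀ {n k} → ℕ → UniformFamily n k → Set
MissesTrace {n} d 𝓕 =
  ∀ (F : Subset n) → F ∈ᶠ 𝓕 →
  ∃[ B ] (B ⊆ F × ∣ B ∣ ≡ d × (∀ (F′ : Subset n) → F′ ∈ᶠ 𝓕 → F′ ∩ F ≢ B))

-- The family consists of all k-element subsets containing a; equality of
-- families is extensional, hence the equivalence.
IsFullStarAt : ∀ {n k} → Fin n → UniformFamily n k → Set
IsFullStarAt {n} {k} a 𝓕 = ∀ (F : Subset n) → F ∈ᶠ 𝓕 ⇔ (∣ F ∣ ≡ k × a ∈ F)

{-# OPTIONS --safe #-}
-- By the size constraints, "F′ ∩ F ≠ B_F for all F′" says that F is the only
-- member containing B_F.  Fix a point z and send F to F ∖ {z} if z ∈ F, and to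
-- B_F otherwise.  By privacy this is an injection into the d-subsets
-- avoiding z, which gives the bound.
--
-- In case of equality the map is onto for every z.  Let F = B_F ∪ {x}.  For
-- y ∈ B_F and z ∉ F, surjectivity at y shows that A = B_F ∖ {y} ∪ {z} is the
-- private set of some member G, and surjectivity at z, applied to F ∖ {y},
-- shows that x ∈ G.  Repeating such exchanges, every d-set avoiding x is the
-- private set of a member through x, so the family is the full star at x.
module Submission where

open import Data.Bool.Properties using () renaming (_≟_ to _≟ᵇ_)
open import Data.Fin using (Fin; zero; suc)
import Data.Fin.Properties as Fin
open import Data.Fin.Subset
  using (Subset; inside; outside; _∈_; _∉_; _⊆_; _∩_; ∣_∣; ⊥)
open import Data.Fin.Subset.Properties
  using (_∈?_; drop-there; p⊂q⇒∣p∣<∣q∣; ⊆-antisym; x∈p∩q⁺; p∩q⊆p; p∩q⊆q; ∣⊥∣≡0)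
open import Data.List using (List; []; _∷_; [_]; _++_; map; length)
open import Data.List.Properties using (length-map; length-++; ++-identityʳ)
import Data.List.Membership.Propositional as List
open import Data.List.Membership.Propositional.Properties
  using (∈-map⁺; ∈-map⁻; ∈-++⁺ˡ; ∈-++⁺ʳ; ∈-∃++)
import Data.List.Membership.DecPropositional as DecMembership
open import Data.List.Relation.Binary.Permutation.Propositional
  using (_↭_; refl; prep; ↭-trans)
open import Data.List.Relation.Binary.Permutation.Propositional.Properties
  using (↭-length; shift; ∈-resp-↭)
open import Data.List.Relation.Unary.All as All using (All; []; _∷_)
import Data.List.Relation.Unary.All.Properties as All
open import Data.List.Relation.Unary.AllPairs using ([]; _∷_)
open import Data.List.Relation.Unary.Any as Any using (here; there)
open import Data.List.Relation.Unary.Unique.Propositional using (Unique)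
import Data.List.Relation.Unary.Unique.Propositional.Properties as Unique
open import Data.Nat using (ℕ; zero; suc; _+_; _∸_; _≤_; _<_; _≥_; z≤n; s≤s; _≤?_)
open import Data.Nat.Combinatorics using (_C_; nCk+nC[k+1]≡[n+1]C[k+1])
open import Data.Nat.Properties
  using (≤-reflexive; ≤-antisym; ≤-trans; <-trans; <⇒≱; ≰⇒>; m≤m+n;
         +-cancelˡ-≡; +-identityʳ; suc-injective; n<1+n)
open import Data.Product using (_×_; _,_; proj₁; proj₂; ∃-syntax)
open import Data.Sum using (_⊎_; inj₁; inj₂)
open import Data.Vec using ([]; _∷_; _[_]≔_; insertAt; removeAt; lookup; here; there)
open import Data.Vec.Properties
  using (≡-dec; ∷-injectiveʳ; []≔-updates; []≔-minimal; lookup∘updateAt;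
         []=⇒lookup; lookup⇒[]=; insertAt-removeAt; removeAt-insertAt; insertAt-lookup)
open import Function using (_∘_)
open import Function.Bundles using (_⇔_; mk⇔; Equivalence)
open import Relation.Binary.PropositionalEquality
  using (_≡_; _≢_; refl; sym; trans; cong; cong₂; subst; module ≡-Reasoning)
open import Relation.Nullary using (Dec; yes; no; contradiction)
open import Defs

private
  variable
    n k d : ℕ
    A B : Set
    p q : Subset n
    u x y z : Fin n

-- Injections between duplicate-free lists

-- Each `x` is split off `ys` at an occurrence; the later entries of `xs` differ from `x`, so they
-- still lie in what remains. The leftover `zs` measures the gap in length.
unique⊆⇒↭ : ∀ {xs ys : List A} → Unique xs → (∀ {x} → x List.∈ xs → x List.∈ ys) →
  ∃[ zs ] ys ↭ xs ++ zs
unique⊆⇒↭ {xs = []} {ys} _ _ = ys , refl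
unique⊆⇒↭ {xs = x ∷ xs} (x∉xs ∷ uxs) sub
  with as , bs , refl ← ∈-∃++ (sub (here refl))
  with zs , eq ← unique⊆⇒↭ {ys = as ++ bs} uxs (λ y∈xs →
         Any.tail (λ y≡x → All.lookup x∉xs y∈xs (sym y≡x))
                  (∈-resp-↭ (shift x as bs) (sub (there y∈xs))))
  = zs , ↭-trans (shift x as bs) (prep x eq)

-- Injectivity is asked only between entries, because the map to be counted is shown injective only
-- on members of the family.
unique-map : ∀ {f : A → B} {xs} →
  (∀ {x y} → x List.∈ xs → y List.∈ xs → f x ≡ f y → x ≡ y) →
  Unique xs → Unique (map f xs)
unique-map inj [] = []
unique-map inj (x∉xs ∷ uxs) =
  All.map⁺ (All.tabulate λ y∈ fx≡fy → All.lookup x∉xs y∈ (inj (here refl) (there y∈) fx≡fy))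
  ∷ unique-map (λ x∈ y∈ → inj (there x∈) (there y∈)) uxs

module _ {f : A → B} {xs ys} (uxs : Unique xs)
         (maps : ∀ {x} → x List.∈ xs → f x List.∈ ys)
         (inj : ∀ {x y} → x List.∈ xs → y List.∈ xs → f x ≡ f y → x ≡ y) where

  private
    extension : ∃[ zs ] ys ↭ map f xs ++ zs
    extension = unique⊆⇒↭ (unique-map inj uxs) λ fx∈ → image (∈-map⁻ f fx∈)
      where
      image : ∀ {y} → ∃[ x ] (x List.∈ xs × y ≡ f x) → y List.∈ ys
      image (_ , x∈ , refl) = maps x∈

    rest : List B
    rest = proj₁ extension

    length-ys : length ys ≡ length xs + length rest
    length-ys = trans (↭-length (proj₂ extension))
      (trans (length-++ (map f xs)) (cong (_+ length rest) (length-map f xs)))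

  injection⇒length≤ : length xs ≤ length ys
  injection⇒length≤ = ≤-trans (m≤m+n _ _) (≤-reflexive (sym length-ys))

  -- Equal lengths force the leftover `rest` to be empty, so `ys` is a permutation of the image.
  injection⇒surjection : length xs ≡ length ys →
    ∀ {y} → y List.∈ ys → ∃[ x ] (x List.∈ xs × y ≡ f x)
  injection⇒surjection eq {y} y∈ with rest | proj₂ extension | length-ys
  ... | []     | ys↭ | _   =
    ∈-map⁻ f (subst (y List.∈_) (++-identityʳ _) (∈-resp-↭ ys↭ y∈))
  ... | _ ∷ _  | _   | len =
    contradiction (+-cancelˡ-≡ (length xs) _ _ (trans (+-identityʳ _) (trans eq len))) λ ()

-- Inserting and deleting a point, and cardinalities

x∉p[x]≔outside : ∀ (p : Subset n) x → x ∉ p [ x ]≔ outside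
x∉p[x]≔outside p x x∈ with () ← trans (sym ([]=⇒lookup x∈)) (lookup∘updateAt x p)

∈-insert : ∀ z → u ∈ p → u ∈ p [ z ]≔ inside
∈-insert {u = u} {p} z u∈p with u Fin.≟ z
... | yes refl = []≔-updates p u
... | no u≢z   = []≔-minimal p u z u≢z u∈p

∈-delete : u ≢ z → u ∈ p → u ∈ p [ z ]≔ outside
∈-delete {u = u} {z} {p} = []≔-minimal p u z

∈-[]≔⁻ : ∀ {s} (p : Subset n) → u ∈ p [ z ]≔ s → u ≡ z ⊎ u ∈ p
∈-[]≔⁻ {z = zero}  (_ ∷ _) here       = inj₁ refl
∈-[]≔⁻ {z = zero}  (_ ∷ _) (there u∈) = inj₂ (there u∈)
∈-[]≔⁻ {z = suc z} (_ ∷ _) here       = inj₂ here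
∈-[]≔⁻ {z = suc z} (_ ∷ p) (there u∈) with ∈-[]≔⁻ p u∈
... | inj₁ refl = inj₁ refl
... | inj₂ u∈p  = inj₂ (there u∈p)

delete-⊆ : ∀ (p : Subset n) z → p [ z ]≔ outside ⊆ p
delete-⊆ p z u∈ with ∈-[]≔⁻ p u∈
... | inj₁ refl = contradiction u∈ (x∉p[x]≔outside p z)
... | inj₂ u∈p  = u∈p

⊆-of-delete : z ∈ q → p [ z ]≔ outside ⊆ q → p ⊆ q
⊆-of-delete {z = z} z∈q sub {u} u∈p with u Fin.≟ z
... | yes refl = z∈q
... | no u≢z   = sub (∈-delete u≢z u∈p)

∣p[x]≔outside∣ : x ∈ p → ∣ p ∣ ≡ suc ∣ p [ x ]≔ outside ∣
∣p[x]≔outside∣ here = refl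
∣p[x]≔outside∣ {p = inside  ∷ _} (there x∈p) = cong suc (∣p[x]≔outside∣ x∈p)
∣p[x]≔outside∣ {p = outside ∷ _} (there x∈p) = ∣p[x]≔outside∣ x∈p

∣p[x]≔inside∣ : ∀ (p : Subset n) {x} → x ∉ p → ∣ p [ x ]≔ inside ∣ ≡ suc ∣ p ∣
∣p[x]≔inside∣ (inside  ∷ _) {zero}  x∉p = contradiction here x∉p
∣p[x]≔inside∣ (outside ∷ _) {zero}  _   = refl
∣p[x]≔inside∣ (inside  ∷ p) {suc x} x∉p = cong suc (∣p[x]≔inside∣ p (x∉p ∘ there))
∣p[x]≔inside∣ (outside ∷ p) {suc x} x∉p = ∣p[x]≔inside∣ p (x∉p ∘ there)

⊆∧∣≥∣⇒≡ : p ⊆ q → ∣ q ∣ ≤ ∣ p ∣ → p ≡ q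
⊆∧∣≥∣⇒≡ {p = p} p⊆q ∣q∣≤∣p∣ = ⊆-antisym p⊆q back
  where
  back : _ ⊆ p
  back {u} u∈q with u ∈? p
  ... | yes u∈p = u∈p
  ... | no  u∉p = contradiction ∣q∣≤∣p∣ (<⇒≱ (p⊂q⇒∣p∣<∣q∣ (p⊆q , u , u∈q , u∉p)))

∣p∣<∣q∣⇒∃∈q∉p : ∀ (p q : Subset n) → ∣ p ∣ < ∣ q ∣ → ∃[ x ] (x ∈ q × x ∉ p)
∣p∣<∣q∣⇒∃∈q∉p (outside ∷ p) (inside ∷ q) _ = zero , here , λ ()
∣p∣<∣q∣⇒∃∈q∉p (inside ∷ p) (inside ∷ q) (s≤s lt)
  with x , x∈q , x∉p ← ∣p∣<∣q∣⇒∃∈q∉p p q lt = suc x , there x∈q , x∉p ∘ drop-there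
∣p∣<∣q∣⇒∃∈q∉p (outside ∷ p) (outside ∷ q) lt
  with x , x∈q , x∉p ← ∣p∣<∣q∣⇒∃∈q∉p p q lt = suc x , there x∈q , x∉p ∘ drop-there
∣p∣<∣q∣⇒∃∈q∉p (inside ∷ p) (outside ∷ q) lt
  with x , x∈q , x∉p ← ∣p∣<∣q∣⇒∃∈q∉p p q (<-trans (n<1+n _) lt) = suc x , there x∈q , x∉p ∘ drop-there

∃-ofSize : k ≤ n → ∃[ p ] ∣_∣ {n} p ≡ k
∃-ofSize {n = n} z≤n = ⊥ , ∣⊥∣≡0 n
∃-ofSize (s≤s k≤n) with p , eq ← ∃-ofSize k≤n = inside ∷ p , cong suc eq

-- Any set of the size of `t` becomes `t` by swaps that trade a point outside `t` for a missing
-- point of `t`. The coordinates are settled one at a time: where the heads differ, comparing the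
-- sizes of the tails yields a partner there, and one swap corrects the head.
exchange-induction : ∀ (Q : Subset n → Set) (t : Subset n) →
  (∀ p {y z} → Q p → y ∈ p → y ∉ t → z ∉ p → z ∈ t →
    Q (p [ y ]≔ outside [ z ]≔ inside)) →
  ∀ p → ∣ p ∣ ≡ ∣ t ∣ → Q p → Q t
exchange-induction Q [] step [] _ Qp = Qp
exchange-induction Q (s ∷ t) step (r ∷ p) eq Qp = go r s eq Qp step
  where
  Exchange : _ → Set
  Exchange s = ∀ p {y z} → Q p → y ∈ p → y ∉ s ∷ t → z ∉ p → z ∈ s ∷ t →
    Q (p [ y ]≔ outside [ z ]≔ inside)

  tail : ∀ s → Exchange s → ∀ p → ∣ p ∣ ≡ ∣ t ∣ → Q (s ∷ p) → Q (s ∷ t)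
  tail s step = exchange-induction (Q ∘ (s ∷_)) t λ p Qp y∈p y∉t z∉p z∈t →
    step (s ∷ p) Qp (there y∈p) (y∉t ∘ drop-there) (z∉p ∘ drop-there) (there z∈t)

  -- The hypothesis is passed as `Exchange s` so that its type refines when `s` is matched.
  go : ∀ r s → ∣ r ∷ p ∣ ≡ ∣ s ∷ t ∣ → Q (r ∷ p) → Exchange s → Q (s ∷ t)
  go inside  inside  eq Qp step = tail inside step p (suc-injective eq) Qp
  go outside outside eq Qp step = tail outside step p eq Qp
  go inside  outside eq Qp step
    with z , z∈t , z∉p ← ∣p∣<∣q∣⇒∃∈q∉p p t (≤-reflexive eq) =
    tail outside step _ (trans (∣p[x]≔inside∣ p z∉p) eq)
      (step (inside ∷ p) Qp here (λ ()) (z∉p ∘ drop-there) (there z∈t))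
  go outside inside  eq Qp step
    with y , y∈p , y∉t ← ∣p∣<∣q∣⇒∃∈q∉p t p (≤-reflexive (sym eq)) =
    tail inside step _ (suc-injective (trans (sym (∣p[x]≔outside∣ y∈p)) eq))
      (step (outside ∷ p) Qp (there y∈p) (y∉t ∘ drop-there) (λ ()) here)

-- Enumerating the subsets of a given size

-- Splitting on the first point follows Pascal's rule, which is what makes the length a binomial
-- coefficient.
kSubsets : ∀ n → ℕ → List (Subset n)
kSubsets zero    zero    = [ [] ]
kSubsets zero    (suc k) = []
kSubsets (suc n) zero    = map (outside ∷_) (kSubsets n zero)
kSubsets (suc n) (suc k) =
  map (inside ∷_) (kSubsets n k) ++ map (outside ∷_) (kSubsets n (suc k))

length-kSubsets : ∀ n k → length (kSubsets n k) ≡ n C k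
length-kSubsets zero    zero    = refl
length-kSubsets zero    (suc k) = refl
length-kSubsets (suc n) zero    = trans (length-map _ (kSubsets n 0)) (length-kSubsets n 0)
length-kSubsets (suc n) (suc k) = begin
  length (map (inside ∷_) (kSubsets n k) ++ map (outside ∷_) (kSubsets n (suc k)))
    ≡⟨ length-++ (map (inside ∷_) (kSubsets n k)) ⟩
  length (map (inside ∷_) (kSubsets n k)) + length (map (outside ∷_) (kSubsets n (suc k)))
    ≡⟨ cong₂ _+_ (trans (length-map _ (kSubsets n k)) (length-kSubsets n k))
                 (trans (length-map _ (kSubsets n (suc k))) (length-kSubsets n (suc k))) ⟩
  n C k + n C suc k
    ≡⟨ nCk+nC[k+1]≡[n+1]C[k+1] n k ⟩
  suc n C suc k ∎
  where open ≡-Reasoning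

kSubsets-complete : ∀ (p : Subset n) → ∣ p ∣ ≡ k → p List.∈ kSubsets n k
kSubsets-complete {k = zero}  []            _  = here refl
kSubsets-complete {k = zero}  (outside ∷ p) eq = ∈-map⁺ _ (kSubsets-complete p eq)
kSubsets-complete {k = suc k} (inside  ∷ p) eq =
  ∈-++⁺ˡ (∈-map⁺ _ (kSubsets-complete p (suc-injective eq)))
kSubsets-complete {k = suc k} (outside ∷ p) eq =
  ∈-++⁺ʳ (map (inside ∷_) _) (∈-map⁺ _ (kSubsets-complete p eq))

kSubsets-sound : ∀ n k → All (λ p → ∣ p ∣ ≡ k) (kSubsets n k)
kSubsets-sound zero    zero    = refl ∷ []
kSubsets-sound zero    (suc k) = []
kSubsets-sound (suc n) zero    = All.map⁺ (kSubsets-sound n zero)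
kSubsets-sound (suc n) (suc k) =
  All.++⁺ (All.map⁺ (All.map (cong suc) (kSubsets-sound n k)))
          (All.map⁺ (kSubsets-sound n (suc k)))

kSubsets-unique : ∀ n k → Unique (kSubsets n k)
kSubsets-unique zero    zero    = [] ∷ []
kSubsets-unique zero    (suc k) = []
kSubsets-unique (suc n) zero    = Unique.map⁺ ∷-injectiveʳ (kSubsets-unique n zero)
kSubsets-unique (suc n) (suc k) =
  Unique.++⁺ (Unique.map⁺ ∷-injectiveʳ (kSubsets-unique n k))
             (Unique.map⁺ ∷-injectiveʳ (kSubsets-unique n (suc k)))
             disjoint
  where
  disjoint : ∀ {p} → p List.∈ map (inside ∷_) (kSubsets n k) ×
                     p List.∈ map (outside ∷_) (kSubsets n (suc k)) → _
  disjoint (p∈ , p∈′) with ∈-map⁻ _ p∈ | ∈-map⁻ _ p∈′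
  ... | _ , _ , refl | _ , _ , ()

∣insertAt∣ : ∀ (p : Subset n) i s → ∣ insertAt p i s ∣ ≡ ∣ s ∷ p ∣
∣insertAt∣ p             zero    s       = refl
∣insertAt∣ (inside  ∷ p) (suc i) inside  = cong suc (∣insertAt∣ p i inside)
∣insertAt∣ (inside  ∷ p) (suc i) outside = cong suc (∣insertAt∣ p i outside)
∣insertAt∣ (outside ∷ p) (suc i) inside  = ∣insertAt∣ p i inside
∣insertAt∣ (outside ∷ p) (suc i) outside = ∣insertAt∣ p i outside

-- Inserting an absent coordinate at `z` turns subsets of `n` points into subsets of `suc n` points
-- avoiding `z`, so the count does not depend on `z`.
kSubsetsAvoiding : Fin (suc n) → ℕ → List (Subset (suc n))
kSubsetsAvoiding {n} z k = map (λ p → insertAt p z outside) (kSubsets n k)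

length-kSubsetsAvoiding : ∀ (z : Fin (suc n)) k → length (kSubsetsAvoiding z k) ≡ n C k
length-kSubsetsAvoiding {n} z k = trans (length-map _ (kSubsets n k)) (length-kSubsets n k)

∉⇒insertAt-outside : ∀ (p : Subset (suc n)) z → z ∉ p → p ≡ insertAt (removeAt p z) z outside
∉⇒insertAt-outside p z z∉p = trans (sym (insertAt-removeAt p z)) (cong (insertAt (removeAt p z) z) value)
  where
  value : lookup p z ≡ outside
  value with lookup p z in eq
  ... | inside  = contradiction (lookup⇒[]= z p eq) z∉p
  ... | outside = refl

kSubsetsAvoiding-complete : ∀ (p : Subset (suc n)) z → z ∉ p → ∣ p ∣ ≡ k →
  p List.∈ kSubsetsAvoiding z k
kSubsetsAvoiding-complete {k = k} p z z∉p ∣p∣≡k =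
  subst (List._∈ kSubsetsAvoiding z k) (sym eq)
    (∈-map⁺ _ (kSubsets-complete (removeAt p z)
      (trans (sym (∣insertAt∣ (removeAt p z) z outside)) (trans (cong ∣_∣ (sym eq)) ∣p∣≡k))))
  where eq = ∉⇒insertAt-outside p z z∉p

-- From missed traces to private subsets

-- `priv` chooses `B_F` as a function of the set alone, independently of the proof of membership;
-- the fields constrain it on members only.
record PrivateSubsets (𝓕 : UniformFamily n (suc d)) : Set where
  field
    priv         : Subset n → Subset n
    priv-⊆       : ∀ {F} → F ∈ᶠ 𝓕 → priv F ⊆ F
    priv-card    : ∀ {F} → F ∈ᶠ 𝓕 → ∣ priv F ∣ ≡ d
    priv-private : ∀ {F G} → F ∈ᶠ 𝓕 → G ∈ᶠ 𝓕 → priv F ⊆ G → F ≡ G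

card : ∀ (𝓕 : UniformFamily n k) {F} → F ∈ᶠ 𝓕 → ∣ F ∣ ≡ k
card 𝓕 = All.lookup (uniform 𝓕)

missesTrace⇒private : ∀ (𝓕 : UniformFamily n (suc d)) → MissesTrace d 𝓕 → PrivateSubsets 𝓕
missesTrace⇒private {n} {d} 𝓕 misses = record
  { priv = λ F → choose F (F ∈ᶠ? members 𝓕)
  ; priv-⊆ = λ {F} F∈ → choose-⊆ F∈ (F ∈ᶠ? members 𝓕)
  ; priv-card = λ {F} F∈ → choose-card F∈ (F ∈ᶠ? members 𝓕)
  ; priv-private = λ {F} F∈ → choose-private F∈ (F ∈ᶠ? members 𝓕)
  }
  where
  open DecMembership (≡-dec _≟ᵇ_) using () renaming (_∈?_ to _∈ᶠ?_)

  choose : ∀ F → Dec (F ∈ᶠ 𝓕) → Subset n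
  choose F (yes F∈) = proj₁ (misses F F∈)
  -- A default value off the family.
  choose F (no _)   = F

  choose-⊆ : ∀ {F} → F ∈ᶠ 𝓕 → (F∈? : Dec (F ∈ᶠ 𝓕)) → choose F F∈? ⊆ F
  choose-⊆ {F} _ (yes F∈) = proj₁ (proj₂ (misses F F∈))
  choose-⊆ F∈ (no F∉)     = contradiction F∈ F∉

  choose-card : ∀ {F} → F ∈ᶠ 𝓕 → (F∈? : Dec (F ∈ᶠ 𝓕)) → ∣ choose F F∈? ∣ ≡ d
  choose-card {F} _ (yes F∈) = proj₁ (proj₂ (proj₂ (misses F F∈)))
  choose-card F∈ (no F∉)     = contradiction F∈ F∉

  -- If `G` contains `B`, then so does `G ∩ F`. When `G ∩ F` has at most `d` points it equals `B`,
  -- which is excluded; otherwise it has `suc d` points, hence is all of `F`, and `F ⊆ G` have equal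
  -- size.
  choose-private : ∀ {F G} → F ∈ᶠ 𝓕 → (F∈? : Dec (F ∈ᶠ 𝓕)) → G ∈ᶠ 𝓕 →
    choose F F∈? ⊆ G → F ≡ G
  choose-private F∈ (no F∉) _ _ = contradiction F∈ F∉
  choose-private {F} {G} _ (yes F∈) G∈ B⊆G
    with B , B⊆F , ∣B∣≡d , misses-B ← misses F F∈ | ∣ G ∩ F ∣ ≤? d
  ... | yes ≤d = contradiction
          (sym (⊆∧∣≥∣⇒≡ (λ u∈B → x∈p∩q⁺ (B⊆G u∈B , B⊆F u∈B))
                        (≤-trans ≤d (≤-reflexive (sym ∣B∣≡d)))))
          (misses-B G G∈)
  ... | no ≰d = ⊆∧∣≥∣⇒≡ F⊆G (≤-reflexive (trans (card 𝓕 G∈) (sym (card 𝓕 F∈))))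
    where
    G∩F≡F : G ∩ F ≡ F
    G∩F≡F = ⊆∧∣≥∣⇒≡ (p∩q⊆q G F) (≤-trans (≤-reflexive (card 𝓕 F∈)) (≰⇒> ≰d))
    F⊆G : F ⊆ G
    F⊆G u∈F = p∩q⊆p G F (subst (_ ∈_) (sym G∩F≡F) u∈F)

-- The trace map at a point

module _ (𝓕 : UniformFamily n (suc d)) (private-subsets : PrivateSubsets 𝓕) where
  open PrivateSubsets private-subsets

  -- The graph of the map at `z`, split by whether `z ∈ F`. Stating it for an arbitrary `P` lets two
  -- sets with the same image be compared by cases.
  data Trace (z : Fin n) (F P : Subset n) : Set where
    through : z ∈ F → F [ z ]≔ outside ≡ P → Trace z F P
    avoids  : z ∉ F → priv F ≡ P → Trace z F P

  trace : Fin n → Subset n → Subset n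
  trace z F with z ∈? F
  ... | yes _ = F [ z ]≔ outside
  ... | no  _ = priv F

  trace-view : ∀ z F → Trace z F (trace z F)
  trace-view z F with z ∈? F
  ... | yes z∈F = through z∈F refl
  ... | no  z∉F = avoids z∉F refl

  -- If both sets pass through `z`, putting `z` back recovers them. In every other case the private
  -- set of one lies inside the other, and privacy identifies them.
  trace-injective : ∀ z {F G P} → F ∈ᶠ 𝓕 → G ∈ᶠ 𝓕 → Trace z F P → Trace z G P → F ≡ G
  trace-injective z {F} {G} _ _ (through z∈F eq) (through z∈G eq′) =
    ⊆-antisym (⊆-of-delete z∈G (delete-⊆ G z ∘ subst (_ ∈_) (trans eq (sym eq′))))
              (⊆-of-delete z∈F (delete-⊆ F z ∘ subst (_ ∈_) (trans eq′ (sym eq))))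
  trace-injective z {F} F∈ G∈ (through _ eq) (avoids _ eq′) =
    sym (priv-private G∈ F∈ (delete-⊆ F z ∘ subst (_ ∈_) (trans eq′ (sym eq))))
  trace-injective z {G = G} F∈ G∈ (avoids _ eq) (through _ eq′) =
    priv-private F∈ G∈ (delete-⊆ G z ∘ subst (_ ∈_) (trans eq (sym eq′)))
  trace-injective z F∈ G∈ (avoids _ eq) (avoids _ eq′) =
    priv-private F∈ G∈ (priv-⊆ G∈ ∘ subst (_ ∈_) (trans eq (sym eq′)))

  card-delete : ∀ {F} → F ∈ᶠ 𝓕 → z ∈ F → ∣ F [ z ]≔ outside ∣ ≡ d
  card-delete F∈ z∈F = suc-injective (trans (sym (∣p[x]≔outside∣ z∈F)) (card 𝓕 F∈))

  trace-card : ∀ {F P} → F ∈ᶠ 𝓕 → Trace z F P → ∣ P ∣ ≡ d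
  trace-card F∈ (through z∈F refl) = card-delete F∈ z∈F
  trace-card F∈ (avoids _ refl)    = priv-card F∈

  trace-avoids : ∀ {F P} → F ∈ᶠ 𝓕 → Trace z F P → z ∉ P
  trace-avoids {z} {F} _ (through _ refl)  = x∉p[x]≔outside F z
  trace-avoids F∈ (avoids z∉F refl) = z∉F ∘ priv-⊆ F∈

  -- Equality case: exchanges and the full star

  module _ (onto : ∀ z P → z ∉ P → ∣ P ∣ ≡ d → ∃[ F ] (F ∈ᶠ 𝓕 × Trace z F P)) where

    -- By cardinality the witness `F` is `A` together with `x`.
    PrivateThrough : Fin n → Subset n → Set
    PrivateThrough x A = ∃[ F ] (F ∈ᶠ 𝓕 × x ∈ F × x ∉ A × priv F ≡ A)

    -- Surjectivity at `y` produces a member `G` with trace `A′`, and surjectivity at `z` produces a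
    -- member `H` with trace `P`. Privacy rules out all cases but the one where `A′` is private to
    -- `G` and `G` equals `H`, which contains `x`.
    exchange : ∀ A → PrivateThrough x A → y ∈ A → z ∉ A → z ≢ x →
      PrivateThrough x (A [ y ]≔ outside [ z ]≔ inside)
    exchange {x} {y} {z} A (F , F∈ , x∈F , x∉A , refl) y∈A z∉A z≢x = main (onto y A′ y∉A′ ∣A′∣≡d)
      where
      A′ P : Subset n
      A′ = A [ y ]≔ outside [ z ]≔ inside
      P  = F [ y ]≔ outside

      y∈F : y ∈ F
      y∈F = priv-⊆ F∈ y∈A

      x∈P : x ∈ P
      x∈P = ∈-delete (λ { refl → x∉A y∈A }) x∈F

      F⊆A+x : F ⊆ A [ x ]≔ inside
      F⊆A+x = subst (_ ∈_) (sym (⊆∧∣≥∣⇒≡ A+x⊆F (≤-reflexive (trans (card 𝓕 F∈)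
          (sym (trans (∣p[x]≔inside∣ A x∉A) (cong suc (priv-card F∈))))))))
        where
        A+x⊆F : A [ x ]≔ inside ⊆ F
        A+x⊆F u∈ with ∈-[]≔⁻ A u∈
        ... | inj₁ refl = x∈F
        ... | inj₂ u∈A  = priv-⊆ F∈ u∈A

      z∉F : z ∉ F
      z∉F z∈F with ∈-[]≔⁻ A (F⊆A+x z∈F)
      ... | inj₁ z≡x = z≢x z≡x
      ... | inj₂ z∈A = z∉A z∈A

      y∉A′ : y ∉ A′
      y∉A′ y∈A′ with ∈-[]≔⁻ (A [ y ]≔ outside) y∈A′
      ... | inj₁ refl = z∉A y∈A
      ... | inj₂ y∈   = x∉p[x]≔outside A y y∈

      x∉A′ : x ∉ A′
      x∉A′ x∈A′ with ∈-[]≔⁻ (A [ y ]≔ outside) x∈A′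
      ... | inj₁ refl = z≢x refl
      ... | inj₂ x∈   = x∉A (delete-⊆ A y x∈)

      ∣A′∣≡d : ∣ A′ ∣ ≡ d
      ∣A′∣≡d = trans (∣p[x]≔inside∣ (A [ y ]≔ outside) (z∉A ∘ delete-⊆ A y))
                     (trans (sym (∣p[x]≔outside∣ y∈A)) (priv-card F∈))

      A-y⊆A′ : A [ y ]≔ outside ⊆ A′
      A-y⊆A′ = ∈-insert z

      z∈A′ : z ∈ A′
      z∈A′ = []≔-updates (A [ y ]≔ outside) z

      A′⊆ : ∀ {G} → z ∈ G → P ⊆ G → A′ ⊆ G
      A′⊆ z∈G P⊆G u∈A′ with ∈-[]≔⁻ (A [ y ]≔ outside) u∈A′
      ... | inj₁ refl = z∈G
      ... | inj₂ u∈   = P⊆G (∈-delete (λ { refl → x∉p[x]≔outside A y u∈ })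
                                      (priv-⊆ F∈ (delete-⊆ A y u∈)))

      main : ∃[ G ] (G ∈ᶠ 𝓕 × Trace y G A′) → PrivateThrough x A′
      -- Here `G` is `A′` with `y` restored, so it contains `A` and must be `F`; but `z` lies in `G`
      -- and not in `F`.
      main (G , G∈ , through y∈G eq) = contradiction (subst (z ∈_) (sym F≡G) z∈G) z∉F
        where
        A′⊆G : A′ ⊆ G
        A′⊆G = delete-⊆ G y ∘ subst (_ ∈_) (sym eq)
        z∈G : z ∈ G
        z∈G = A′⊆G z∈A′
        F≡G : F ≡ G
        F≡G = priv-private F∈ G∈ (⊆-of-delete y∈G (A′⊆G ∘ A-y⊆A′))
      main (G , G∈ , avoids _ privG≡A′)
        with onto z P (z∉F ∘ delete-⊆ F y) (card-delete F∈ y∈F)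
      -- Now `H` is `P` with `z` added, so it contains `A′`, the private set of `G`.
      ... | H , H∈ , through z∈H eq = G , G∈ , subst (x ∈_) (sym G≡H) (P⊆H x∈P) , x∉A′ , privG≡A′
        where
        P⊆H : P ⊆ H
        P⊆H = delete-⊆ H z ∘ subst (_ ∈_) (sym eq)
        G≡H : G ≡ H
        G≡H = priv-private G∈ H∈ (A′⊆ z∈H P⊆H ∘ subst (_ ∈_) privG≡A′)
      -- The private set `P` of `H` lies in `F`, so `H` is `F` and `P` would be `A`; but `x` lies in
      -- `P` and not in `A`.
      ... | H , H∈ , avoids _ privH≡P
        with refl ← priv-private H∈ F∈ (delete-⊆ F y ∘ subst (_ ∈_) privH≡P) =
        contradiction (subst (x ∈_) (sym privH≡P) x∈P) x∉A

    -- Every swap towards `T` brings in a point of `T`, which differs from `x` since `x ∉ T`; so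
    -- `exchange` applies at each stage.
    all-private : ∀ {A} → PrivateThrough x A → ∣ A ∣ ≡ d →
      ∀ T → ∣ T ∣ ≡ d → x ∉ T → PrivateThrough x T
    all-private {x} {A} start ∣A∣≡d T ∣T∣≡d x∉T =
      exchange-induction (PrivateThrough x) T
        (λ B Q y∈B _ z∉B z∈T → exchange B Q y∈B z∉B λ { refl → x∉T z∈T })
        A (trans ∣A∣≡d (sym ∣T∣≡d)) start

    -- The centre `a` is the point of `F₀` outside its private set.
    onto⇒fullStar : ∀ {F} → F ∈ᶠ 𝓕 → ∃[ a ] IsFullStarAt a 𝓕
    onto⇒fullStar {F₀} F₀∈
      with a , a∈F₀ , a∉A ← ∣p∣<∣q∣⇒∃∈q∉p (priv F₀) F₀
        (≤-reflexive (trans (cong suc (priv-card F₀∈)) (sym (card 𝓕 F₀∈)))) =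
      a , λ F → mk⇔ (λ F∈ → card 𝓕 F∈ , contains F∈) (λ (∣F∣≡ , a∈F) → member ∣F∣≡ a∈F)
      where
      private-at-a : ∀ T → ∣ T ∣ ≡ d → a ∉ T → PrivateThrough a T
      private-at-a = all-private (F₀ , F₀∈ , a∈F₀ , a∉A , refl) (priv-card F₀∈)

      -- If `a ∉ F`, then `priv F` avoids `a` and is also the private set of a member through `a`;
      -- privacy makes that member `F`.
      contains : ∀ {F} → F ∈ᶠ 𝓕 → a ∈ F
      contains {F} F∈ with a ∈? F
      ... | yes a∈F = a∈F
      ... | no a∉F
        with G , G∈ , a∈G , _ , eq ← private-at-a (priv F) (priv-card F∈) (a∉F ∘ priv-⊆ F∈) =
        subst (a ∈_) (priv-private G∈ F∈ (priv-⊆ F∈ ∘ subst (_ ∈_) eq)) a∈G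

      -- `F` without `a` is the private set of some member `G` through `a`, so `F ⊆ G`, and the
      -- sizes agree.
      member : ∀ {F} → ∣ F ∣ ≡ suc d → a ∈ F → F ∈ᶠ 𝓕
      member {F} ∣F∣≡ a∈F
        with G , G∈ , a∈G , _ , eq ← private-at-a (F [ a ]≔ outside)
          (suc-injective (trans (sym (∣p[x]≔outside∣ a∈F)) ∣F∣≡)) (x∉p[x]≔outside F a) =
        subst (_∈ᶠ 𝓕) (sym (⊆∧∣≥∣⇒≡ (⊆-of-delete a∈G (priv-⊆ G∈ ∘ subst (_ ∈_) (sym eq)))
          (≤-reflexive (trans (card 𝓕 G∈) (sym ∣F∣≡))))) G∈

-- Counting: the bound and the equality case

module _ (𝓕 : UniformFamily (suc n) (suc d)) (private-subsets : PrivateSubsets 𝓕) where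

  private
    tr : Fin (suc n) → Subset (suc n) → Subset (suc n)
    tr = trace 𝓕 private-subsets

    view : ∀ z F → Trace 𝓕 private-subsets z F (tr z F)
    view = trace-view 𝓕 private-subsets

    maps : ∀ z {F} → F ∈ᶠ 𝓕 → tr z F List.∈ kSubsetsAvoiding z d
    maps z {F} F∈ = kSubsetsAvoiding-complete (tr z F) z
      (trace-avoids 𝓕 private-subsets F∈ (view z F)) (trace-card 𝓕 private-subsets F∈ (view z F))

    injective : ∀ z {F G} → F ∈ᶠ 𝓕 → G ∈ᶠ 𝓕 → tr z F ≡ tr z G → F ≡ G
    injective z {F} {G} F∈ G∈ eq = trace-injective 𝓕 private-subsets z F∈ G∈ (view z F)
      (subst (Trace 𝓕 private-subsets z G) (sym eq) (view z G))

  size≤ : size 𝓕 ≤ n C d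
  -- For the bound a single point suffices; `zero` is taken.
  size≤ = subst (size 𝓕 ≤_) (length-kSubsetsAvoiding zero d)
    (injection⇒length≤ (distinct 𝓕) (maps zero) (injective zero))

  -- The target list has length `n C d` for every `z`, so one numerical equality gives surjectivity
  -- at all points at once.
  size≡⇒onto : size 𝓕 ≡ n C d → ∀ z P → z ∉ P → ∣ P ∣ ≡ d →
    ∃[ F ] (F ∈ᶠ 𝓕 × Trace 𝓕 private-subsets z F P)
  size≡⇒onto eq z P z∉P ∣P∣≡d
    with F , F∈ , refl ← injection⇒surjection (distinct 𝓕) (maps z) (injective z)
           (trans eq (sym (length-kSubsetsAvoiding z d)))
           (kSubsetsAvoiding-complete P z z∉P ∣P∣≡d) =
    F , F∈ , view z F

-- Inserting `a` injects the `d`-subsets of the other `n` points into the star; `removeAt` undoes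
-- it.
fullStar⇒size≥ : ∀ (𝓕 : UniformFamily (suc n) (suc d)) {a} → IsFullStarAt a 𝓕 → n C d ≤ size 𝓕
fullStar⇒size≥ {n} {d} 𝓕 {a} star = subst (_≤ size 𝓕) (length-kSubsets n d)
  (injection⇒length≤ {f = λ p → insertAt p a inside} (kSubsets-unique n d) maps
    λ {p} {q} _ _ eq → trans (sym (removeAt-insertAt p a inside))
      (trans (cong (λ r → removeAt r a) eq) (removeAt-insertAt q a inside)))
  where
  maps : ∀ {p} → p List.∈ kSubsets n d → insertAt p a inside ∈ᶠ 𝓕
  maps {p} p∈ = Equivalence.from (star (insertAt p a inside))
    ( trans (∣insertAt∣ p a inside) (cong suc (All.lookup (kSubsets-sound n d) p∈))
    , lookup⇒[]= a _ (insertAt-lookup p a inside))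

theorem5p1 : ∀ (n d : ℕ) → n ≥ suc d → suc d ≥ 3 →
    ∀ (𝓕 : UniformFamily n (suc d)) → MissesTrace d 𝓕 →
    (size 𝓕 ≤ (n ∸ 1) C d) ×
    (size 𝓕 ≡ (n ∸ 1) C d ⇔ (∃[ a ] IsFullStarAt a 𝓕))
theorem5p1 (suc m) d (s≤s m≥d) _ 𝓕 misses =
  size≤ 𝓕 privs ,
  mk⇔ size≡⇒fullStar (λ (_ , star) → ≤-antisym (size≤ 𝓕 privs) (fullStar⇒size≥ 𝓕 star))
  where
  privs = missesTrace⇒private 𝓕 misses

  size≡⇒fullStar : size 𝓕 ≡ m C d → ∃[ a ] IsFullStarAt a 𝓕
  size≡⇒fullStar eq
    -- A starting member is needed. As `m ≥ d`, some `d`-set avoids `zero`, and surjectivity there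
    -- gives it a preimage in the family.
    with P , ∣P∣≡d ← ∃-ofSize m≥d
    with F , F∈ , _ ← size≡⇒onto 𝓕 privs eq zero (outside ∷ P) (λ ()) ∣P∣≡d =
    onto⇒fullStar 𝓕 privs (size≡⇒onto 𝓕 privs eq) F∈
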